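{- For all Kripke structures with team $(\mathcal K,T)$, all formulas $\varphi$ of modal team logic $\mathsf{MTL}$ (with the propositional variables of $\varphi$ interpreted in $\mathcal K$), and any first-order variable $x$, it holds that $(\mathcal K,T)\vDash\varphi$ if and only if $(\mathcal A(\mathcal K),T^x)\vDash\mathsf{st}_x(\varphi)$.
   Context: Modal team logic. $\mathsf{ML}$-formulas: $\alpha::=\neg\alpha\mid\alpha\wedge\alpha\mid\alpha\vee\alpha\mid\Box\alpha\mid\Diamond\alpha\mid p$, with $p$ ranging over propositional variables $p_1,p_2,\ldots$. $\mathsf{MTL}$-formulas: $\varphi::={\sim}\varphi\mid\varphi\wedge\varphi\mid\varphi\vee\varphi\mid\Box\varphi\mid\Diamond\varphi\mid\alpha$ with $\alpha\in\mathsf{ML}$. A Kripke structure over a finite set $X$ of propositional variables is $\mathcal K=(W,R,V)$ with $R\subseteq W\times W$ and $V\colon X\to\mathfrak P(W)$. A team in $\mathcal K$ is a set $T\subseteq W$. $Rw=\{v\mid Rwv\}$ and $RT=\bigcup_{w\in T}Rw$. A successor team of $T$ is a set $S\subseteq RT$ such that every $w\in T$ has some $R$-successor in $S$. Semantics: if $\varphi\in\mathsf{ML}$, $(\mathcal K,T)\vDash\varphi$ iff $(\mathcal K,w)\vDash\varphi$ in usual Kripke semantics for all $w\in T$; otherwise $(\mathcal K,T)\vDash{\sim}\psi$ iff $(\mathcal K,T)\nvDash\psi$; $\wedge$ is conjunction; $(\mathcal K,T)\vDash\psi\vee\theta$ iff $T=S\cup U$ for some $S,U\subseteq T$ with $(\mathcal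 K,S)\vDash\psi$, $(\mathcal K,U)\vDash\theta$; $(\mathcal K,T)\vDash\Diamond\psi$ iff $(\mathcal K,S)\vDash\psi$ for some successor team $S$ of $T$; $(\mathcal K,T)\vDash\Box\psi$ iff $(\mathcal K,RT)\vDash\psi$. First-order team logic $\mathsf{FO}(\sim)$ has the formulas $\varphi ::= \alpha \mid {\sim}\varphi \mid \varphi\wedge\varphi \mid \varphi\vee\varphi \mid \exists x\,\varphi \mid \forall x\,\varphi$ with $\alpha$ an ordinary first-order formula. A team $T$ in $\mathcal A$ with domain $X$ is a set of assignments $s\colon X\to\mathrm{dom}\,\mathcal A$. For $f\colon T\to\mathfrak P(\mathrm{dom}\,\mathcal A)\setminus\{\emptyset\}$ let $T^x_f=\{s^x_a\mid s\in T,a\in f(s)\}$, where $s^x_a$ maps $x$ to $a$ and otherwise agrees with $s$; $T^x_A$ is the case $f(s)=A$ constant. Semantics: if $\varphi\in\mathsf{FO}$, $(\mathcal A,T)\vDash\varphi$ iff $(\mathcal A,s)\vDash\varphi$ (Tarski) for all $s\in T$; otherwise ${\sim},\wedge,\vee$ as in $\mathsf{MTL}$ (with $\vee$ splitting $T=S\cup U$); $(\mathcal A,T)\vDash\exists x\,\psi$ iff $(\mathcal A,T^x_f)\vDash\psi$ for some $f\colon T\to\mathfrak P(\mathrm{dom}\,\mathcal A)\setminus\{\emptyset\}$; $(\mathcal A,T)\vDash\forall x\,\psi$ iff $(\mathcal A,T^x_{\mathrm{dom}\,\mathcal A})\vDash\psi$. For $\alpha\in\mathsf{FO}$, $\alpha\hookrightarrow\varphi$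 abbreviates $\neg\alpha\vee(\alpha\wedge\varphi)$. Translation. For two distinct variables $x,y$ and vocabulary $\{R,P_1,P_2,\ldots\}$ ($R$ binary, $P_i$ unary): $\mathsf{st}_x(p_i)=P_ix$; $\mathsf{st}_x(\neg\varphi)=\neg\mathsf{st}_x(\varphi)$; $\mathsf{st}_x({\sim}\varphi)={\sim}\mathsf{st}_x(\varphi)$; $\mathsf{st}_x(\varphi\wedge\psi)=\mathsf{st}_x(\varphi)\wedge\mathsf{st}_x(\psi)$; $\mathsf{st}_x(\varphi\vee\psi)=\mathsf{st}_x(\varphi)\vee\mathsf{st}_x(\psi)$; $\mathsf{st}_x(\Box\varphi)=\forall y\,(Rxy\hookrightarrow\mathsf{st}_y(\varphi))$; $\mathsf{st}_x(\Diamond\varphi)=\exists y\,(Rxy\wedge\mathsf{st}_y(\varphi))$; $\mathsf{st}_y$ is defined symmetrically with $x,y$ exchanged. For $\mathcal K=(W,R,V)$, the structure $\mathcal A(\mathcal K)$ has domain $W$, interprets $R$ by the accessibility relation and $P_i$ by $V(p_i)$. For $w\in W$, $w^x\colon\{x\}\to W$ is the assignment $x\mapsto w$, and $T^x=\{w^x\mid w\in T\}$. -}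

module Defs where

open import Level using (0ℓ; Lift)
open import Data.Empty using (⊥-elim)
open import Data.Irrelevant as Irrelevant using ([_])
open import Data.List using (List; []; _∷_)
open import Data.List.Membership.Propositional using () renaming (_∈_ to _∈ˡ_)
open import Data.List.Relation.Unary.Any using (here; there)
open import Data.Nat using (ℕ; _≟_)
open import Data.Product using (Σ-syntax; ∃-syntax; _×_; _,_)
open import Data.Refinement using (Refinement; _,_)
open import Data.Sum using (_⊎_)
open import Data.Vec as Vec using (Vec; []; _∷_)
open import Relation.Binary.Core using (Rel)
open import Relation.Binary.Definitions using (_Respects_)
open import Relation.Binary.PropositionalEquality using (_≡_; _≢_; refl; sym; trans; _≗_)
open import Relation.Nullary using (¬_; yes; no)
open import Relation.Unary using (Pred; _∈_; _⊆_; _∪_; _≐_; Satisfiable; U)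

infix  8 ¬ᶠ_ ~_ □_ ◇_
infixr 7 _∧_
infixr 6 _∨_ _↪ᶠ_ _↪_

-- Finite sets of naturals.  Membership proofs are irrelevant in `Elem X`, so
-- order and multiplicity in the list are invisible.
FinSet : Set
FinSet = List ℕ

Elem : FinSet → Set
Elem X = Refinement ℕ (_∈ˡ X)

elem : ∀ {X} (v : ℕ) → .(v ∈ˡ X) → Elem X
elem v v∈X = v , [ v∈X ]

------------------------------------------------------------------------
-- Modal team logic

-- Formulas whose propositional variables lie in X.

data ML (X : FinSet) : Set where
  var     : Elem X → ML X
  ¬ᶠ_     : ML X → ML X
  _∧_ _∨_ : ML X → ML X → ML X
  □_ ◇_   : ML X → ML X

-- A formula in ML is read as ⌜ α ⌝; the other constructors give the team
-- semantics.  Where both readings exist (e.g. ⌜ α ∨ β ⌝ and ⌜ α ⌝ ∨ ⌜ β ⌝)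
-- they are satisfied by the same teams, since ML is flat.
data MTL (X : FinSet) : Set where
  ⌜_⌝     : ML X → MTL X
  ~_      : MTL X → MTL X
  _∧_ _∨_ : MTL X → MTL X → MTL X
  □_ ◇_   : MTL X → MTL X

record Kripke (X : FinSet) : Set₁ where
  field
    W : Set
    R : Rel W 0ℓ
    V : Elem X → Pred W 0ℓ

  Image : Pred W 0ℓ → Pred W 0ℓ
  Image T v = ∃[ w ] w ∈ T × R w v

  SuccessorTeam : Pred W 0ℓ → Pred W 0ℓ → Set
  SuccessorTeam T S = S ⊆ Image T × (∀ w → w ∈ T → ∃[ v ] R w v × v ∈ S)

open Kripke public using (W)

infix 3 _∙_⊨ᴹᴸ_ _∙_⊨ᴹᵀᴸ_

_∙_⊨ᴹᴸ_ : ∀ {X} (K : Kripke X) → W K → ML X → Set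
K ∙ w ⊨ᴹᴸ var p = w ∈ Kripke.V K p
K ∙ w ⊨ᴹᴸ ¬ᶠ α  = ¬ (K ∙ w ⊨ᴹᴸ α)
K ∙ w ⊨ᴹᴸ α ∧ β = (K ∙ w ⊨ᴹᴸ α) × (K ∙ w ⊨ᴹᴸ β)
K ∙ w ⊨ᴹᴸ α ∨ β = (K ∙ w ⊨ᴹᴸ α) ⊎ (K ∙ w ⊨ᴹᴸ β)
K ∙ w ⊨ᴹᴸ □ α   = ∀ v → Kripke.R K w v → K ∙ v ⊨ᴹᴸ α
K ∙ w ⊨ᴹᴸ ◇ α   = ∃[ v ] Kripke.R K w v × (K ∙ v ⊨ᴹᴸ α)

-- The team semantics quantifies over teams, hence lives in Set₁.
_∙_⊨ᴹᵀᴸ_ : ∀ {X} (K : Kripke X) → Pred (W K) 0ℓ → MTL X → Set₁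
K ∙ T ⊨ᴹᵀᴸ ⌜ α ⌝ = Lift _ (∀ w → w ∈ T → K ∙ w ⊨ᴹᴸ α)
K ∙ T ⊨ᴹᵀᴸ ~ φ   = ¬ (K ∙ T ⊨ᴹᵀᴸ φ)
K ∙ T ⊨ᴹᵀᴸ φ ∧ ψ = (K ∙ T ⊨ᴹᵀᴸ φ) × (K ∙ T ⊨ᴹᵀᴸ ψ)
K ∙ T ⊨ᴹᵀᴸ φ ∨ ψ = Σ[ S₁ ∈ Pred (W K) 0ℓ ] Σ[ S₂ ∈ Pred (W K) 0ℓ ]
                     T ≐ S₁ ∪ S₂ × (K ∙ S₁ ⊨ᴹᵀᴸ φ) × (K ∙ S₂ ⊨ᴹᵀᴸ ψ)
K ∙ T ⊨ᴹᵀᴸ □ φ   = K ∙ Kripke.Image K T ⊨ᴹᵀᴸ φ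
K ∙ T ⊨ᴹᵀᴸ ◇ φ   = Σ[ S ∈ Pred (W K) 0ℓ ] Kripke.SuccessorTeam K T S × (K ∙ S ⊨ᴹᵀᴸ φ)

------------------------------------------------------------------------
-- First-order team logic

Var : Set
Var = ℕ

-- The relation symbols of each arity.
Vocabulary : Set₁
Vocabulary = ℕ → Set

-- Formulas over the vocabulary τ whose free variables lie in D.

data FO (τ : Vocabulary) (D : FinSet) : Set where
  _==_    : Elem D → Elem D → FO τ D
  rel     : ∀ {n} → τ n → Vec (Elem D) n → FO τ D
  ¬ᶠ_     : FO τ D → FO τ D
  _∧_ _∨_ : FO τ D → FO τ D → FO τ D
  ∃ᶠ ∀ᶠ   : (x : Var) → FO τ (x ∷ D) → FO τ D

data FO∼ (τ : Vocabulary) (D : FinSet) : Set where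
  ⌜_⌝     : FO τ D → FO∼ τ D
  ~_      : FO∼ τ D → FO∼ τ D
  _∧_ _∨_ : FO∼ τ D → FO∼ τ D → FO∼ τ D
  ∃ᶠ ∀ᶠ   : (x : Var) → FO∼ τ (x ∷ D) → FO∼ τ D

-- α ↪ φ abbreviates ¬α ∨ (α ∧ φ), which is an FO formula when φ is.  Its use in
-- the translation of □ is classical: satisfying it decides α, so relating it
-- to the Kripke semantics of □ takes excluded middle.

_↪ᶠ_ : ∀ {τ D} → FO τ D → FO τ D → FO τ D
α ↪ᶠ β = ¬ᶠ α ∨ (α ∧ β)

_↪_ : ∀ {τ D} → FO τ D → FO∼ τ D → FO∼ τ D
α ↪ φ = ⌜ ¬ᶠ α ⌝ ∨ (⌜ α ⌝ ∧ φ)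

record Structure (τ : Vocabulary) : Set₁ where
  field
    dom    : Set
    interp : ∀ {n} → τ n → Pred (Vec dom n) 0ℓ

open Structure public using (dom)

Assignment : FinSet → Set → Set
Assignment D A = Elem D → A

private
  ∈-tail : ∀ {v x : Var} {D : FinSet} → v ≢ x → v ∈ˡ (x ∷ D) → v ∈ˡ D
  ∈-tail v≢x (here v≡x)  = ⊥-elim (v≢x v≡x)
  ∈-tail v≢x (there v∈D) = v∈D

infix 9 _[_↦_]
infixl 8 _^[_]_ _^_

_[_↦_] : ∀ {D A} → Assignment D A → (x : Var) → A → Assignment (x ∷ D) A
(s [ x ↦ a ]) (v , v∈xD) with v ≟ x
... | yes _   = a
... | no  v≢x = s (v , Irrelevant.map (∈-tail v≢x) v∈xD)

-- Assignments are functions, so equality of assignments is pointwise; sets of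
-- assignments (and set-valued functions on them) must respect it.
record Team (D : FinSet) (A : Set) : Set₁ where
  field
    ⟦_⟧  : Pred (Assignment D A) 0ℓ
    resp : ⟦_⟧ Respects _≗_

open Team public using (⟦_⟧)

-- Functions from assignments to 𝔓(A).  For T^x_f only the values on T matter.
record SetFunction (D : FinSet) (A : Set) : Set₁ where
  field
    values : Assignment D A → Pred A 0ℓ
    resp   : ∀ {a} → (λ s → a ∈ values s) Respects _≗_

open SetFunction public using (values)

NonemptyOn : ∀ {D A} → Team D A → SetFunction D A → Set
NonemptyOn T f = ∀ s → s ∈ ⟦ T ⟧ → Satisfiable (values f s)

-- The team T^x_f.
_^[_]_ : ∀ {D A} → Team D A → (x : Var) → SetFunction D A → Team (x ∷ D) A
T ^[ x ] f = record
  { ⟦_⟧  = λ t → ∃[ s ] ∃[ a ] s ∈ ⟦ T ⟧ × a ∈ values f s × t ≗ s [ x ↦ a ]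
  ; resp = λ t≗t′ (s , a , s∈T , a∈fs , t≗) →
             s , a , s∈T , a∈fs , λ v → trans (sym (t≗t′ v)) (t≗ v)
  }

full : ∀ {D A} → SetFunction D A
full = record { values = λ _ → U ; resp = λ _ a∈U → a∈U }

infix 3 _∙_⊨ᶠᵒ_ _∙_⊨ᶠᵒ∼_

_∙_⊨ᶠᵒ_ : ∀ {τ D} (𝔄 : Structure τ) → Assignment D (dom 𝔄) → FO τ D → Set
𝔄 ∙ s ⊨ᶠᵒ x == y   = s x ≡ s y
𝔄 ∙ s ⊨ᶠᵒ rel P xs = Vec.map s xs ∈ Structure.interp 𝔄 P
𝔄 ∙ s ⊨ᶠᵒ ¬ᶠ α     = ¬ (𝔄 ∙ s ⊨ᶠᵒ α)
𝔄 ∙ s ⊨ᶠᵒ α ∧ β    = (𝔄 ∙ s ⊨ᶠᵒ α) × (𝔄 ∙ s ⊨ᶠᵒ β)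
𝔄 ∙ s ⊨ᶠᵒ α ∨ β    = (𝔄 ∙ s ⊨ᶠᵒ α) ⊎ (𝔄 ∙ s ⊨ᶠᵒ β)
𝔄 ∙ s ⊨ᶠᵒ ∃ᶠ x α   = ∃[ a ] (𝔄 ∙ s [ x ↦ a ] ⊨ᶠᵒ α)
𝔄 ∙ s ⊨ᶠᵒ ∀ᶠ x α   = ∀ a → 𝔄 ∙ s [ x ↦ a ] ⊨ᶠᵒ α

_∙_⊨ᶠᵒ∼_ : ∀ {τ D} (𝔄 : Structure τ) → Team D (dom 𝔄) → FO∼ τ D → Set₁
𝔄 ∙ T ⊨ᶠᵒ∼ ⌜ α ⌝  = Lift _ (∀ s → s ∈ ⟦ T ⟧ → 𝔄 ∙ s ⊨ᶠᵒ α)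
𝔄 ∙ T ⊨ᶠᵒ∼ ~ φ    = ¬ (𝔄 ∙ T ⊨ᶠᵒ∼ φ)
𝔄 ∙ T ⊨ᶠᵒ∼ φ ∧ ψ  = (𝔄 ∙ T ⊨ᶠᵒ∼ φ) × (𝔄 ∙ T ⊨ᶠᵒ∼ ψ)
_∙_⊨ᶠᵒ∼_ {D = D} 𝔄 T (φ ∨ ψ) =
  Σ[ S₁ ∈ Team D (dom 𝔄) ] Σ[ S₂ ∈ Team D (dom 𝔄) ]
    ⟦ T ⟧ ≐ ⟦ S₁ ⟧ ∪ ⟦ S₂ ⟧ × (𝔄 ∙ S₁ ⊨ᶠᵒ∼ φ) × (𝔄 ∙ S₂ ⊨ᶠᵒ∼ ψ)
_∙_⊨ᶠᵒ∼_ {D = D} 𝔄 T (∃ᶠ x φ) =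
  Σ[ f ∈ SetFunction D (dom 𝔄) ] NonemptyOn T f × (𝔄 ∙ T ^[ x ] f ⊨ᶠᵒ∼ φ)
𝔄 ∙ T ⊨ᶠᵒ∼ ∀ᶠ x φ = 𝔄 ∙ T ^[ x ] full ⊨ᶠᵒ∼ φ

------------------------------------------------------------------------
-- Standard translation

data ModalVoc (X : FinSet) : Vocabulary where
  𝐑 : ModalVoc X 2
  𝐏 : Elem X → ModalVoc X 1

-- The domain D must be general, because st_x(φ) occurs below quantifiers; the
-- irrelevant argument says that x is in scope.

stᴹᴸ : ∀ {X D} (x y : Var) → .(x ∈ˡ D) → ML X → FO (ModalVoc X) D
stᴹᴸ x y x∈D (var p) = rel (𝐏 p) (elem x x∈D ∷ [])
stᴹᴸ x y x∈D (¬ᶠ α)  = ¬ᶠ stᴹᴸ x y x∈D α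
stᴹᴸ x y x∈D (α ∧ β) = stᴹᴸ x y x∈D α ∧ stᴹᴸ x y x∈D β
stᴹᴸ x y x∈D (α ∨ β) = stᴹᴸ x y x∈D α ∨ stᴹᴸ x y x∈D β
stᴹᴸ x y x∈D (□ α)   =
  ∀ᶠ y (rel 𝐑 (elem x (there x∈D) ∷ elem y (here refl) ∷ []) ↪ᶠ stᴹᴸ y x (here refl) α)
stᴹᴸ x y x∈D (◇ α)   =
  ∃ᶠ y (rel 𝐑 (elem x (there x∈D) ∷ elem y (here refl) ∷ []) ∧ stᴹᴸ y x (here refl) α)

stᴹᵀᴸ : ∀ {X D} (x y : Var) → .(x ∈ˡ D) → MTL X → FO∼ (ModalVoc X) D
stᴹᵀᴸ x y x∈D ⌜ α ⌝   = ⌜ stᴹᴸ x y x∈D α ⌝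
stᴹᵀᴸ x y x∈D (~ φ)   = ~ stᴹᵀᴸ x y x∈D φ
stᴹᵀᴸ x y x∈D (φ ∧ ψ) = stᴹᵀᴸ x y x∈D φ ∧ stᴹᵀᴸ x y x∈D ψ
stᴹᵀᴸ x y x∈D (φ ∨ ψ) = stᴹᵀᴸ x y x∈D φ ∨ stᴹᵀᴸ x y x∈D ψ
stᴹᵀᴸ x y x∈D (□ φ)   =
  ∀ᶠ y (rel 𝐑 (elem x (there x∈D) ∷ elem y (here refl) ∷ []) ↪ stᴹᵀᴸ y x (here refl) φ)
stᴹᵀᴸ x y x∈D (◇ φ)   =
  ∃ᶠ y (⌜ rel 𝐑 (elem x (there x∈D) ∷ elem y (here refl) ∷ []) ⌝ ∧ stᴹᵀᴸ y x (here refl) φ)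

-- st_x(φ), with y as the other variable.
st : ∀ {X} (x y : Var) → MTL X → FO∼ (ModalVoc X) (x ∷ [])
st x y φ = stᴹᵀᴸ x y (here refl) φ

𝒜 : ∀ {X} → Kripke X → Structure (ModalVoc X)
𝒜 {X} K = record { dom = W K ; interp = interp }
  where
  interp : ∀ {n} → ModalVoc X n → Pred (Vec (W K) n) 0ℓ
  interp 𝐑     (w ∷ v ∷ []) = Kripke.R K w v
  interp (𝐏 p) (w ∷ [])     = w ∈ Kripke.V K p

-- On the one-element domain {x}, the assignment x ↦ w is a constant function.
singleton : ∀ {A : Set} (x : Var) → A → Assignment (x ∷ []) A
singleton x w _ = w

-- The team T^x.
_^_ : ∀ {A} → Pred A 0ℓ → (x : Var) → Team (x ∷ []) A
T ^ x = record
  { ⟦_⟧  = λ s → ∃[ w ] w ∈ T × s ≗ singleton x w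
  ; resp = λ s≗t (w , w∈T , s≗) → w , w∈T , λ v → trans (sym (s≗t v)) (s≗ v)
  }

{-# OPTIONS --safe #-}
module Submission where

-- Satisfaction of st_x(φ) depends on a team only through the values it gives
-- to x.  So the theorem is proved by induction on φ for every team T′, over any
-- domain containing x, whose set of x-values is T; the split or supplementation
-- on one side is the image or preimage, under s ↦ s(x), of that on the other.

open import Defs
open import Level using (0ℓ; lift)
open import Axiom.ExcludedMiddle using (ExcludedMiddle)
open import Data.List using (_∷_)
open import Data.List.Membership.Propositional using () renaming (_∈_ to _∈ˡ_)
open import Data.List.Relation.Unary.Any using (here; there)
open import Data.Nat using (_≟_)
open import Data.Product using (∃-syntax; _×_; _,_; proj₁; proj₂)
open import Data.Product.Function.NonDependent.Propositional using (_×-⇔_)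
open import Data.Sum as Sum using (inj₁; inj₂; [_,_]′)
open import Data.Sum.Function.Propositional using (_⊎-⇔_)
open import Function.Base using (_∘_)
open import Function.Bundles using (_⇔_; mk⇔; Equivalence)
open import Function.Properties.Equivalence using () renaming (refl to ⇔-refl)
open import Relation.Binary.PropositionalEquality using (_≡_; _≢_; refl; sym; trans; subst; subst₂; _≗_)
open import Relation.Nullary using (¬_; yes; no; toSum)
open import Relation.Nullary.Negation using (contradiction)
open import Relation.Unary using (Pred; _∈_; _∪_; _≐_)

open Equivalence using (to; from)

¬-⇔ : ∀ {a b} {A : Set a} {B : Set b} → A ⇔ B → (¬ A) ⇔ (¬ B)
¬-⇔ A⇔B = mk⇔ (λ ¬a → ¬a ∘ from A⇔B) (λ ¬b → ¬b ∘ to A⇔B)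

module _ {A : Set} where

  update-same : ∀ {D} (s : Assignment D A) (x : Var) {a : A} →
                (s [ x ↦ a ]) (elem x (here refl)) ≡ a
  update-same s x with x ≟ x
  ... | yes _   = refl
  ... | no  x≢x = contradiction refl x≢x

  update-other : ∀ {D x y} → x ≢ y → (s : Assignment D A) {a : A} .(x∈D : x ∈ˡ D) →
                 (s [ y ↦ a ]) (elem x (there x∈D)) ≡ s (elem x x∈D)
  update-other {x = x} {y = y} x≢y s x∈D with x ≟ y
  ... | yes x≡y = contradiction x≡y x≢y
  ... | no  _   = refl

  Values : ∀ {D} → Team D A → Elem D → Pred A 0ℓ
  Values T′ e w = ∃[ s ] s ∈ ⟦ T′ ⟧ × s e ≡ w

  infix 4 _IsValuesOf_at_

  -- A relation, not an equation with `Values`: predicates with the same members need not be equal,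
  -- and this form lets the induction hypothesis be used directly at a given `S` or at `Image T`.
  _IsValuesOf_at_ : ∀ {D} → Pred A 0ℓ → Team D A → Elem D → Set
  T IsValuesOf T′ at e = (∀ {w} → w ∈ T → w ∈ Values T′ e) × (∀ {s} → s ∈ ⟦ T′ ⟧ → s e ∈ T)

  Values-isValues : ∀ {D} (T′ : Team D A) (e : Elem D) → Values T′ e IsValuesOf T′ at e
  Values-isValues T′ e = (λ w∈ → w∈) , λ {s} s∈T′ → s , s∈T′ , refl

  restrict : ∀ {D} → Team D A → (P : Pred (Assignment D A) 0ℓ) →
             (∀ {s t} → s ≗ t → s ∈ P → t ∈ P) → Team D A
  restrict T′ P P-resp = record
    { ⟦_⟧  = λ s → s ∈ ⟦ T′ ⟧ × s ∈ P
    ; resp = λ s≗t (s∈T′ , s∈P) → Team.resp T′ s≗t s∈T′ , P-resp s≗t s∈P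
    }

-- Level `0ℓ` suffices although team satisfaction lives in `Set₁`: only instances of `R` are
-- decided, in the two `□` cases.
module Correctness (em : ExcludedMiddle 0ℓ) {X : FinSet} (K : Kripke X) where

  open Kripke K using (R; Image)

  -- Only the value of `s` at `x` is fixed, since quantifiers extend the domain. Under a modality
  -- the roles of `x` and `y` are exchanged; `x ≢ y` keeps the value at `x` intact when `y` is
  -- updated, so the guard still compares `w` with `v`.
  stᴹᴸ-correct : ∀ {D x y} .(x∈D : x ∈ˡ D) → x ≢ y → (α : ML X) {w : W K} (s : Assignment D (W K)) →
                 s (elem x x∈D) ≡ w → (K ∙ w ⊨ᴹᴸ α) ⇔ (𝒜 K ∙ s ⊨ᶠᵒ stᴹᴸ x y x∈D α)
  stᴹᴸ-correct x∈D x≢y (var p) s refl = ⇔-refl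
  stᴹᴸ-correct x∈D x≢y (¬ᶠ α) s sx = ¬-⇔ (stᴹᴸ-correct x∈D x≢y α s sx)
  stᴹᴸ-correct x∈D x≢y (α ∧ β) s sx =
    stᴹᴸ-correct x∈D x≢y α s sx ×-⇔ stᴹᴸ-correct x∈D x≢y β s sx
  stᴹᴸ-correct x∈D x≢y (α ∨ β) s sx =
    stᴹᴸ-correct x∈D x≢y α s sx ⊎-⇔ stᴹᴸ-correct x∈D x≢y β s sx
  stᴹᴸ-correct {x = x} {y} x∈D x≢y (□ α) {w} s sx = mk⇔ forth back
    where
    ih = λ v → stᴹᴸ-correct (here refl) (x≢y ∘ sym) α (s [ y ↦ v ]) (update-same s y)
    at-x = λ v → trans (update-other x≢y s {v} x∈D) sx
    at-y = λ v → update-same s y {v}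
    forth : K ∙ w ⊨ᴹᴸ □ α → 𝒜 K ∙ s ⊨ᶠᵒ stᴹᴸ x y x∈D (□ α)
    -- The translated disjunction must commit to one side, so `R w v` has to be decided here.
    forth h v with em {R w v}
    ... | yes r = inj₂ (subst₂ R (sym (at-x v)) (sym (at-y v)) r , to (ih v) (h v r))
    ... | no ¬r = inj₁ (¬r ∘ subst₂ R (at-x v) (at-y v))
    back : 𝒜 K ∙ s ⊨ᶠᵒ stᴹᴸ x y x∈D (□ α) → K ∙ w ⊨ᴹᴸ □ α
    back h v r with h v
    ... | inj₁ ¬r      = contradiction (subst₂ R (sym (at-x v)) (sym (at-y v)) r) ¬r
    ... | inj₂ (_ , p) = from (ih v) p
  stᴹᴸ-correct {y = y} x∈D x≢y (◇ α) s sx = mk⇔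
    (λ (v , r , p) → v , subst₂ R (sym (at-x v)) (sym (at-y v)) r , to (ih v) p)
    (λ (v , r , p) → v , subst₂ R (at-x v) (at-y v) r , from (ih v) p)
    where
    ih = λ v → stᴹᴸ-correct (here refl) (x≢y ∘ sym) α (s [ y ↦ v ]) (update-same s y)
    at-x = λ v → trans (update-other x≢y s {v} x∈D) sx
    at-y = λ v → update-same s y {v}

  -- Both directions are proved together because `~` exchanges them.
  stᴹᵀᴸ-correct : ∀ {D x y} .(x∈D : x ∈ˡ D) → x ≢ y → (φ : MTL X)
                  {T : Pred (W K) 0ℓ} (T′ : Team D (W K)) → T IsValuesOf T′ at elem x x∈D →
                  (K ∙ T ⊨ᴹᵀᴸ φ) ⇔ (𝒜 K ∙ T′ ⊨ᶠᵒ∼ stᴹᵀᴸ x y x∈D φ)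
  stᴹᵀᴸ-correct x∈D x≢y ⌜ α ⌝ T′ (T⊆ , ⊆T) = mk⇔
    (λ (lift h) → lift λ s s∈T′ → to (stᴹᴸ-correct x∈D x≢y α s refl) (h _ (⊆T s∈T′)))
    (λ (lift h) → lift λ w w∈T → let s , s∈T′ , sx = T⊆ w∈T in
                                 from (stᴹᴸ-correct x∈D x≢y α s sx) (h s s∈T′))
  stᴹᵀᴸ-correct x∈D x≢y (~ φ) T′ T≐ = ¬-⇔ (stᴹᵀᴸ-correct x∈D x≢y φ T′ T≐)
  stᴹᵀᴸ-correct x∈D x≢y (φ ∧ ψ) T′ T≐ =
    stᴹᵀᴸ-correct x∈D x≢y φ T′ T≐ ×-⇔ stᴹᵀᴸ-correct x∈D x≢y ψ T′ T≐
  stᴹᵀᴸ-correct {D} {x} x∈D x≢y (φ ∨ ψ) {T} T′ (T⊆ , ⊆T) = mk⇔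
    (λ (S₁ , S₂ , (T⊆S , S⊆T) , p , q) →
      preimage S₁ , preimage S₂ ,
      ((λ s∈T′ → Sum.map (s∈T′ ,_) (s∈T′ ,_) (T⊆S (⊆T s∈T′))) , [ proj₁ , proj₁ ]′) ,
      to (stᴹᵀᴸ-correct x∈D x≢y φ _ (preimage-values S₁ (S⊆T ∘ inj₁))) p ,
      to (stᴹᵀᴸ-correct x∈D x≢y ψ _ (preimage-values S₂ (S⊆T ∘ inj₂))) q)
    (λ (S₁ , S₂ , (T′⊆S , S⊆T′) , p , q) →
      Values S₁ e , Values S₂ e ,
      ((λ w∈T → let s , s∈T′ , sx = T⊆ w∈T in
                Sum.map (λ s∈S → s , s∈S , sx) (λ s∈S → s , s∈S , sx) (T′⊆S s∈T′)) ,
       [ (λ (s , s∈S , sx) → subst T sx (⊆T (S⊆T′ (inj₁ s∈S)))) ,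
         (λ (s , s∈S , sx) → subst T sx (⊆T (S⊆T′ (inj₂ s∈S)))) ]′) ,
      from (stᴹᵀᴸ-correct x∈D x≢y φ S₁ (Values-isValues S₁ e)) p ,
      from (stᴹᵀᴸ-correct x∈D x≢y ψ S₂ (Values-isValues S₂ e)) q)
    where
    e : Elem D
    e = elem x x∈D
    preimage : Pred (W K) 0ℓ → Team D (W K)
    preimage S = restrict T′ (λ s → s e ∈ S) (λ s≗t → subst S (s≗t e))
    -- As `S` lies inside `T`, each of its members is attained by some assignment of `T′`, which
    -- then belongs to the preimage.
    preimage-values : ∀ S → (∀ {w} → w ∈ S → w ∈ T) → S IsValuesOf preimage S at e
    preimage-values S S⊆T =
      (λ w∈S → let s , s∈T′ , sx = T⊆ (S⊆T w∈S) in s , (s∈T′ , subst S (sym sx) w∈S) , sx) , proj₂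
  stᴹᵀᴸ-correct {D} {x} {y} x∈D x≢y (□ φ) {T} T′ (T⊆ , ⊆T) = mk⇔
    (λ p → nonedges , edges ,
      split , lift (λ _ → proj₂) , lift (λ _ → proj₂) ,
      to (stᴹᵀᴸ-correct (here refl) (x≢y ∘ sym) φ edges
           (image-values edges proj₁ proj₂ (λ t∈ r → t∈ , r))) p)
    -- The guards leave no freedom in the split: `S₂` contains only edges, and an edge cannot lie in
    -- `S₁`, so `S₂` has exactly the members of `edges`.
    (λ (S₁ , S₂ , (T′⊆S , S⊆T′) , lift ¬r , lift r , p) →
      from (stᴹᵀᴸ-correct (here refl) (x≢y ∘ sym) φ S₂
             (image-values S₂ (S⊆T′ ∘ inj₂) (r _)
               (λ t∈ rt → [ (λ t∈S₁ → contradiction rt (¬r _ t∈S₁)) , (λ t∈S₂ → t∈S₂) ]′ (T′⊆S t∈)))) p)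
    where
    ex ey : Elem (y ∷ D)
    ex = elem x (there x∈D)
    ey = elem y (here refl)
    T″ : Team (y ∷ D) (W K)
    T″ = T′ ^[ y ] full
    edges nonedges : Team (y ∷ D) (W K)
    edges = restrict T″ (λ t → R (t ex) (t ey)) (λ s≗t → subst₂ R (s≗t ex) (s≗t ey))
    nonedges = restrict T″ (λ t → ¬ R (t ex) (t ey))
                 (λ s≗t ¬r → ¬r ∘ subst₂ R (sym (s≗t ex)) (sym (s≗t ey)))
    split : ⟦ T″ ⟧ ≐ ⟦ nonedges ⟧ ∪ ⟦ edges ⟧
    -- Excluded middle is what makes the two parts cover `T″`; the swap puts the negative case
    -- first, as in `↪`.
    split = (λ t∈ → Sum.swap (Sum.map (t∈ ,_) (t∈ ,_) (toSum em))) , [ proj₁ , proj₁ ]′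
    -- Stated for any `S` with the members of `edges`, so that it serves both the split constructed
    -- from `□` and an arbitrary given one.
    image-values : (S : Team (y ∷ D) (W K)) → (∀ {t} → t ∈ ⟦ S ⟧ → t ∈ ⟦ T″ ⟧) →
                   (∀ {t} → t ∈ ⟦ S ⟧ → R (t ex) (t ey)) →
                   (∀ {t} → t ∈ ⟦ T″ ⟧ → R (t ex) (t ey) → t ∈ ⟦ S ⟧) →
                   Image T IsValuesOf S at ey
    image-values S S⊆T″ S⊆R ⊆S =
      (λ {v} (w , w∈T , r) →
        let s , s∈T′ , sx = T⊆ w∈T
            at-x = trans (update-other x≢y s {v} x∈D) sx
            at-y = update-same s y {v}
        in s [ y ↦ v ] ,
           ⊆S (s , v , s∈T′ , _ , λ _ → refl) (subst₂ R (sym at-x) (sym at-y) r) ,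
           at-y) ,
      (λ {t} t∈S →
        let s , a , s∈T′ , _ , t≗ = S⊆T″ t∈S
        in _ , ⊆T s∈T′ , subst (λ w → R w (t ey)) (trans (t≗ ex) (update-other x≢y s x∈D)) (S⊆R t∈S))
  stᴹᵀᴸ-correct {D} {x} {y} x∈D x≢y (◇ φ) {T} T′ (T⊆ , ⊆T) = mk⇔
    (λ (S , (S⊆ , succ) , p) →
      successors S ,
      (λ s s∈T′ → let v , r , v∈S = succ _ (⊆T s∈T′) in v , v∈S , r) ,
      lift (λ t (s , a , _ , (_ , r) , t≗) →
        subst₂ R (sym (trans (t≗ ex) (update-other x≢y s x∈D)))
                 (sym (trans (t≗ ey) (update-same s y))) r) ,
      to (stᴹᵀᴸ-correct (here refl) (x≢y ∘ sym) φ _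
           ((λ {v} v∈S →
              let w , w∈T , r = S⊆ v∈S
                  s , s∈T′ , sx = T⊆ w∈T
              in s [ y ↦ v ] ,
                 (s , v , s∈T′ , (v∈S , subst (λ u → R u v) (sym sx) r) , λ _ → refl) ,
                 update-same s y) ,
            (λ (s , a , _ , (a∈S , _) , t≗) →
              subst S (sym (trans (t≗ ey) (update-same s y))) a∈S))) p)
    (λ (f , nonempty , lift r , p) →
      -- The `y`-values form a successor team: the guard places each in `Image T`, and nonemptiness
      -- of `f` at an assignment sending `x` to `w` supplies a successor of `w`.
      Values (T′ ^[ y ] f) ey ,
      ((λ (t , t∈@(s , a , s∈T′ , _ , t≗) , ty) →
         _ , ⊆T s∈T′ , subst₂ R (trans (t≗ ex) (update-other x≢y s x∈D)) ty (r t t∈)) ,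
       (λ w w∈T →
         let s , s∈T′ , sx = T⊆ w∈T
             v , v∈f = nonempty s s∈T′
             at-x = trans (update-other x≢y s {v} x∈D) sx
             at-y = update-same s y {v}
             t∈ = s , v , s∈T′ , v∈f , λ _ → refl
         in v , subst₂ R at-x at-y (r _ t∈) , _ , t∈ , at-y)) ,
      from (stᴹᵀᴸ-correct (here refl) (x≢y ∘ sym) φ _ (Values-isValues (T′ ^[ y ] f) ey)) p)
    where
    e : Elem D
    e = elem x x∈D
    ex ey : Elem (y ∷ D)
    ex = elem x (there x∈D)
    ey = elem y (here refl)
    -- Intersecting `S` with the successors of `s e` makes the guard hold. The two halves of
    -- `SuccessorTeam` are what remains: every `w` in `T` having a successor in `S` makes the values
    -- nonempty, and `S` lying inside `Image T` makes every member of `S` a value of `y`.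
    successors : Pred (W K) 0ℓ → SetFunction D (W K)
    successors S = record
      { values = λ s v → v ∈ S × R (s e) v
      ; resp   = λ s≗t (v∈S , r) → v∈S , subst (λ u → R u _) (s≗t e) r
      }

theorem5p2 : ExcludedMiddle 0ℓ →
    ∀ {X : FinSet} (K : Kripke X) (T : Pred (W K) 0ℓ) (φ : MTL X) (x y : Var) → x ≢ y →
    (K ∙ T ⊨ᴹᵀᴸ φ) ⇔ (𝒜 K ∙ (T ^ x) ⊨ᶠᵒ∼ st x y φ)
theorem5p2 em K T φ x y x≢y = stᴹᵀᴸ-correct (here refl) x≢y φ (T ^ x)
  ( (λ {w} w∈T → singleton x w , (w , w∈T , λ _ → refl) , refl)
  , (λ (w , w∈T , s≗) → subst T (sym (s≗ _)) w∈T))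
  where open Correctness em K
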